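{- Let $\xi=(L^\xi,\Delta_0^\xi,B^\xi,d,G)$ be a generic configuration that is EA-stable. Then the axiom system $B^\xi+\mathrm{SelfCons}^1(B^\xi,d)$ (with deduction method $d$) is self-justifying.
   Context: **Generic configurations.** Standard-M is the standard model of the natural numbers. $\mathrm{Log}$ is the base-2 logarithm. A generic configuration $\xi$ is a 5-tuple $(L^\xi,\Delta_0^\xi,B^\xi,d,G)$ where: (1) $L^\xi$ is a language with symbols for $0,1,2,=,\le$ and $\mathrm{Maximum}(x,y)$, and enough function and constant symbols that every integer $k$ is the value of some term $T_k$. (2) $\Delta_0^\xi$ is a fixed class of fully bounded $L^\xi$-formulas (all quantifiers have the form $\exists v\le T$ or $\forall v\le T$ with $T$ a term), closed under negation, and rich enough to contain two formulas $\mathrm{Add}(x,y,z)$ and $\mathrm{Mult}(x,y,z)$ defining the graphs of addition and multiplication. Every $\Delta_0^\xi$ formula is both $\Pi_0^\xi$ and $\Sigma_0^\xi$; for $n\ge1$ a formula is $\Pi_n^\xi$ (resp. $\Sigma_n^\xi$) iff it can be written $\forall v_1\cdots\forall v_k\,\Phi$ with $\Phi\in\Sigma_{n-1}^\xi$ (resp. $\exists v_1\cdots\exists v_k\,\Phi$ with $\Phi\in\Pi_{n-1}^\xi$); $\Delta_0^\xi$ sentences count as both $\Pi_1^\xi$ and $\Sigma_1^\xi$. (3) $B^\xi$ (the base axiom system) is an axiom system whose axioms are true in Standard-M and which is $\Sigma_1^\xi$-complete: it proves every true $\Sigma_1^\xi$ sentence and refutes every false $\Pi_1^\xi$ sentence.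 (4) $d$ is a deduction method, conventional enough to satisfy the indirect-implication property associated with Gödel's Completeness Theorem: whether or not modus ponens is built in, whenever it can prove $X$, $Y$ and $(X\wedge Y)\to Z$, it can prove $Z$ (possibly by a much longer proof). (5) $G$ is a method for encoding the Gödel numbers of proofs. Proofs are identified with their Gödel numbers $p$. **Goodness.** $E(N)$ is a term of value $2^N$. For a prenex sentence $\Upsilon$, $\mathrm{Scope}_E(\Upsilon,N)$ is obtained from $\Upsilon$ by replacing each unbounded $\forall v$ by $\forall v<E(N)$ and each unbounded $\exists v$ by $\exists v<E(N)$, leaving the bounded quantifiers of the $\Delta_0^\xi$ part unchanged. A $\Pi_1^\xi$ or $\Sigma_1^\xi$ sentence $\Upsilon$ is $\mathrm{Good}(N)$ when $\mathrm{Scope}_E(\Upsilon,N)$ is true in Standard-M ($\mathrm{Good}(\infty)$ means true in Standard-M). For a set $\theta$ of $\Pi_1^\xi$ sentences, $\sharp(\theta)$ is the largest integer $J$ such that every sentence of $\theta$ is $\mathrm{Good}(J)$, and $\sharp(\theta)=\infty$ if this holds for all $J$. **Stability.** $\mathrm{RE\text{ - }Class}(\xi)$ is the set of all recursively enumerable sets $\theta$ of $\Pi_1^\xi$ sentences (true or not). - $\xi$ is A-stable iff for every $\theta\in\mathrm{RE\text{ - }Class}(\xi)$: if $\Upsilon$ is a $\Pi_1^\xi$ theorem of $\theta\cup B^\xi$ via a proof $p$ with $\mathrm{Log}(p)\le\sharp(\theta)+1$, then $\Upsilon$ is $\mathrm{Good}\{\tfrac12\sharp(\theta)\}$. - $\xi$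 is E-stable iff for every $\theta\in\mathrm{RE\text{ - }Class}(\xi)$: if $\Upsilon$ is a $\Sigma_1^\xi$ theorem of $\theta\cup B^\xi$ via a proof $p$ with $\mathrm{Log}(p)\le\sharp(\theta)+1$, then $\Upsilon$ is $\mathrm{Good}\{\tfrac12\lfloor\mathrm{Log}(p)\rfloor-1\}$. - $\xi$ is EA-stable iff it is both E-stable and A-stable. **Self-consistency axioms.** An axiom system $\alpha\supseteq B^\xi$ is Level$(k^\xi)$ consistent when there are no proofs from $\alpha$ via $d$ of both a $\Pi_k^\xi$ sentence and the $\Sigma_k^\xi$ sentence that is its negation. For $\beta\supseteq B^\xi$, $\mathrm{SelfCons}^k(\beta,d)$ is a self-referencing $\Pi_1^\xi$ sentence asserting the Level$(k^\xi)$ consistency of $\beta+\mathrm{SelfCons}^k(\beta,d)$. Explicitly, use $\Delta_0^\xi$ formulas: $\mathrm{Neg}^k(x,y)$: $x$ is the Gödel number of a $\Pi_k^\xi$ sentence and $y$ that of the $\Sigma_k^\xi$ sentence which is its negation; $\mathrm{SubstPrf}^d_\beta(g,t,p)$: there is $h$ such that $h$ encodes the sentence obtained from the formula with code $g$ by replacing its free variables by the numeral $\bar g$, and $p$ is a proof of $t$ via $d$ from $\beta$ together with the sentence coded by $h$. Let $\Gamma^k(g)$ be $\forall x\forall y\forall p\forall q\ \neg\{\mathrm{Neg}^k(x,y)\wedge\mathrm{SubstPrf}^d_\beta(g,x,p)\wedge\mathrm{SubstPrf}^d_\beta(g,y,q)\}$ and $n$ its Gödel number; then $\mathrm{SelfCons}^k(\beta,d)$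 is $\Gamma^k(\bar n)$. **Self-justification.** A pair $(\alpha,d)$ (axiom system, deduction method) is self-justifying when (i) one of $\alpha$'s theorems states that $d$, applied to $\alpha$, produces a consistent set of theorems, and (ii) $\alpha$ is in fact consistent. -}

module Defs where

open import Data.Bool.Base using (Bool; true; not; _∧_; _∨_)
open import Data.Fin.Base using (Fin; zero; suc)
open import Data.Integer.Base using (+_; -[1+_])
open import Data.Nat.Base using (ℕ; zero; suc; _+_; _*_; _^_; _⊔_; _≤_; _<_)
open import Data.Nat.Logarithm using (⌊log₂_⌋)
open import Data.Product.Base using (Σ; ∃; ∃-syntax; _×_; _,_)
open import Data.Rational.Unnormalised.Base as ℚᵘ using (ℚᵘ; mkℚᵘ; ½; 1ℚᵘ; _/_)
open import Data.Unit.Base using (⊤)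
open import Data.Vec.Base using (Vec; []; _∷_; lookup; map; replicate; tabulate)
open import Function.Base using (_∘_)
open import Function.Bundles using (_⇔_)
open import Function.Definitions using (Injective)
open import Relation.Binary.PropositionalEquality.Core using (_≡_)
open import Relation.Nullary.Construct.Add.Supremum using (_⁺)
  renaming ([_] to fin; ⊤⁺ to ∞)
open import Relation.Nullary.Negation.Core using (¬_)
open import Relation.Unary using (_∪_; ｛_｝; _≐_)

------------------------------------------------------------------------
-- Recursively enumerable sets

data Rec : ℕ → Set where
  zer  : Rec 0
  succ : Rec 1
  proj : ∀ {n} → Fin n → Rec n
  comp : ∀ {m n} → Rec m → Vec (Rec n) m → Rec n
  prec : ∀ {n} → Rec n → Rec (suc (suc n)) → Rec (suc n)
  mu   : ∀ {n} → Rec (suc n) → Rec n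

infix 4 _⟨_⟩⇓_ _⟨_⟩⇓*_

mutual
  data _⟨_⟩⇓_ : ∀ {n} → Rec n → Vec ℕ n → ℕ → Set where
    ⇓zer   : zer ⟨ [] ⟩⇓ 0
    ⇓succ  : ∀ {x} → succ ⟨ x ∷ [] ⟩⇓ suc x
    ⇓proj  : ∀ {n} {i : Fin n} {xs} → proj i ⟨ xs ⟩⇓ lookup xs i
    ⇓comp  : ∀ {m n} {f : Rec m} {gs : Vec (Rec n) m} {xs ys z} →
             gs ⟨ xs ⟩⇓* ys → f ⟨ ys ⟩⇓ z → comp f gs ⟨ xs ⟩⇓ z
    ⇓prec₀ : ∀ {n} {f : Rec n} {g xs y} →
             f ⟨ xs ⟩⇓ y → prec f g ⟨ 0 ∷ xs ⟩⇓ y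
    ⇓precₛ : ∀ {n} {f : Rec n} {g k xs r y} →
             prec f g ⟨ k ∷ xs ⟩⇓ r → g ⟨ k ∷ r ∷ xs ⟩⇓ y →
             prec f g ⟨ suc k ∷ xs ⟩⇓ y
    ⇓mu    : ∀ {n} {f : Rec (suc n)} {xs k} →
             f ⟨ k ∷ xs ⟩⇓ 0 →
             (∀ j → j < k → ∃[ y ] f ⟨ j ∷ xs ⟩⇓ suc y) →
             mu f ⟨ xs ⟩⇓ k

  data _⟨_⟩⇓*_ : ∀ {m n} → Vec (Rec n) m → Vec ℕ n → Vec ℕ m → Set where
    []  : ∀ {n} {xs : Vec ℕ n} → [] ⟨ xs ⟩⇓* []
    _∷_ : ∀ {m n} {g : Rec n} {gs : Vec (Rec n) m} {xs y ys} →
          g ⟨ xs ⟩⇓ y → gs ⟨ xs ⟩⇓* ys → (g ∷ gs) ⟨ xs ⟩⇓* (y ∷ ys)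

-- The range of a partial recursive function.
RecursivelyEnumerable : (ℕ → Set) → Set
RecursivelyEnumerable S = ∃[ f ] (∀ n → S n ⇔ (∃[ m ] f ⟨ m ∷ [] ⟩⇓ n))

------------------------------------------------------------------------
-- Languages and their formulas

-- The predicate symbols are = and ≤ for every language; constants are
-- function symbols of arity 0.  The interpretation is that of Standard-M.
record Language : Set₁ where
  field
    Func : ℕ → Set
    ⟦_⟧ᶠ : ∀ {k} → Func k → Vec ℕ k → ℕ

    c0 c1 c2 : Func 0
    maximum  : Func 2

    c0-value      : ⟦ c0 ⟧ᶠ [] ≡ 0
    c1-value      : ⟦ c1 ⟧ᶠ [] ≡ 1
    c2-value      : ⟦ c2 ⟧ᶠ [] ≡ 2
    maximum-value : ∀ x y → ⟦ maximum ⟧ᶠ (x ∷ y ∷ []) ≡ x ⊔ y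

module Syntax (L : Language) where
  open Language L

  -- Term n and Formula n: free variables are de Bruijn indices in Fin n.
  data Term (n : ℕ) : Set where
    var : Fin n → Term n
    fun : ∀ {k} → Func k → Vec (Term n) k → Term n

  infix  8 _≈'_ _≤'_
  infixr 7 _∧'_
  infixr 6 _∨'_
  infixr 5 _⇒'_

  -- In ∀≤ t φ and ∃≤ t φ the bound t lies outside the scope of the
  -- quantified variable.
  data Formula (n : ℕ) : Set where
    _≈'_ _≤'_           : Term n → Term n → Formula n
    ¬'_                 : Formula n → Formula n
    _∧'_ _∨'_ _⇒'_      : Formula n → Formula n → Formula n
    ∀'_ ∃'_             : Formula (suc n) → Formula n
    ∀≤ ∃≤               : Term n → Formula (suc n) → Formula n

  Sentence : Set
  Sentence = Formula 0

  Axioms : Set₁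
  Axioms = Sentence → Set

  infixl 6 _+ᵃ_
  _+ᵃ_ : Axioms → Sentence → Axioms
  β +ᵃ φ = ｛ φ ｝ ∪ β

  mutual
    _[_]ₜ : ∀ {m n} → Term n → Vec (Term m) n → Term m
    var i    [ σ ]ₜ = lookup σ i
    fun f ts [ σ ]ₜ = fun f (ts [ σ ]ₜₛ)

    _[_]ₜₛ : ∀ {m n k} → Vec (Term n) k → Vec (Term m) n → Vec (Term m) k
    []       [ σ ]ₜₛ = []
    (t ∷ ts) [ σ ]ₜₛ = t [ σ ]ₜ ∷ ts [ σ ]ₜₛ

  wk : ∀ {n} → Term n → Term (suc n)
  wk t = t [ tabulate (var ∘ suc) ]ₜ

  lift : ∀ {m n} → Vec (Term m) n → Vec (Term (suc m)) (suc n)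
  lift σ = var zero ∷ map wk σ

  _[_] : ∀ {m n} → Formula n → Vec (Term m) n → Formula m
  (t ≈' u) [ σ ] = (t [ σ ]ₜ) ≈' (u [ σ ]ₜ)
  (t ≤' u) [ σ ] = (t [ σ ]ₜ) ≤' (u [ σ ]ₜ)
  (¬' φ)   [ σ ] = ¬' (φ [ σ ])
  (φ ∧' ψ) [ σ ] = (φ [ σ ]) ∧' (ψ [ σ ])
  (φ ∨' ψ) [ σ ] = (φ [ σ ]) ∨' (ψ [ σ ])
  (φ ⇒' ψ) [ σ ] = (φ [ σ ]) ⇒' (ψ [ σ ])
  (∀' φ)   [ σ ] = ∀' (φ [ lift σ ])
  (∃' φ)   [ σ ] = ∃' (φ [ lift σ ])
  ∀≤ t φ   [ σ ] = ∀≤ (t [ σ ]ₜ) (φ [ lift σ ])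
  ∃≤ t φ   [ σ ] = ∃≤ (t [ σ ]ₜ) (φ [ lift σ ])

  closed : ∀ {n} → Term 0 → Term n
  closed t = t [ [] ]ₜ

  mutual
    value : ∀ {n} → Term n → Vec ℕ n → ℕ
    value (var i)    ρ = lookup ρ i
    value (fun f ts) ρ = ⟦ f ⟧ᶠ (values ts ρ)

    values : ∀ {n k} → Vec (Term n) k → Vec ℕ n → Vec ℕ k
    values []       ρ = []
    values (t ∷ ts) ρ = value t ρ ∷ values ts ρ

  -- Satisfaction in Standard-M.  Truth is classical: disjunction and the
  -- existential quantifiers are read as ¬(¬ ∧ ¬) and ¬∀¬, so that every
  -- Sat φ ρ is stable under double negation.
  Sat : ∀ {n} → Formula n → Vec ℕ n → Set
  Sat (t ≈' u) ρ = value t ρ ≡ value u ρ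
  Sat (t ≤' u) ρ = value t ρ ≤ value u ρ
  Sat (¬' φ)   ρ = ¬ Sat φ ρ
  Sat (φ ∧' ψ) ρ = Sat φ ρ × Sat ψ ρ
  Sat (φ ∨' ψ) ρ = ¬ (¬ Sat φ ρ × ¬ Sat ψ ρ)
  Sat (φ ⇒' ψ) ρ = Sat φ ρ → Sat ψ ρ
  Sat (∀' φ)   ρ = ∀ k → Sat φ (k ∷ ρ)
  Sat (∃' φ)   ρ = ¬ (∀ k → ¬ Sat φ (k ∷ ρ))
  Sat (∀≤ t φ) ρ = ∀ k → k ≤ value t ρ → Sat φ (k ∷ ρ)
  Sat (∃≤ t φ) ρ = ¬ (∀ k → k ≤ value t ρ → ¬ Sat φ (k ∷ ρ))

  True : Sentence → Set
  True φ = Sat φ []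

  data FullyBounded {n : ℕ} : Formula n → Set where
    eq   : ∀ {t u} → FullyBounded (t ≈' u)
    le   : ∀ {t u} → FullyBounded (t ≤' u)
    neg  : ∀ {φ} → FullyBounded φ → FullyBounded (¬' φ)
    conj : ∀ {φ ψ} → FullyBounded φ → FullyBounded ψ → FullyBounded (φ ∧' ψ)
    disj : ∀ {φ ψ} → FullyBounded φ → FullyBounded ψ → FullyBounded (φ ∨' ψ)
    impl : ∀ {φ ψ} → FullyBounded φ → FullyBounded ψ → FullyBounded (φ ⇒' ψ)
    all≤ : ∀ {t φ} → FullyBounded φ → FullyBounded (∀≤ t φ)
    ex≤  : ∀ {t φ} → FullyBounded φ → FullyBounded (∃≤ t φ)

  -- The negation of a prenex formula as a prenex formula.
  dual : ∀ {n} → Formula n → Formula n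
  dual (∀' φ) = ∃' (dual φ)
  dual (∃' φ) = ∀' (dual φ)
  dual φ      = ¬' φ

  _<'_ : ∀ {n} → Term n → Term n → Formula n
  t <' u = ¬' (u ≤' t)

  -- ∀ v < t and ∃ v < t, written with the bounded quantifiers ∀ v ≤ t and
  -- ∃ v ≤ t.
  ∀< ∃< : ∀ {n} → Term n → Formula (suc n) → Formula n
  ∀< t φ = ∀≤ t ((var zero <' wk t) ⇒' φ)
  ∃< t φ = ∃≤ t ((var zero <' wk t) ∧' φ)

  Scope : ∀ {n} → Term 0 → Formula n → Formula n
  Scope E (∀' φ) = ∀< (closed E) (Scope E φ)
  Scope E (∃' φ) = ∃< (closed E) (Scope E φ)
  Scope E φ      = φ

  record IsValuation (v : Sentence → Bool) : Set where
    field
      v-¬ : ∀ φ → v (¬' φ) ≡ not (v φ)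
      v-∧ : ∀ φ ψ → v (φ ∧' ψ) ≡ v φ ∧ v ψ
      v-∨ : ∀ φ ψ → v (φ ∨' ψ) ≡ v φ ∨ v ψ
      v-⇒ : ∀ φ ψ → v (φ ⇒' ψ) ≡ not (v φ) ∨ v ψ

  Tautology : Sentence → Set
  Tautology φ = ∀ v → IsValuation v → v φ ≡ true

------------------------------------------------------------------------
-- The arithmetical hierarchy over a class Δ₀

module Hierarchy (L : Language) (Δ₀ : ∀ {n} → Syntax.Formula L n → Set) where
  open Syntax L

  -- The blocks of quantifiers may be empty.
  mutual
    data IsΠ : ℕ → ∀ {n} → Formula n → Set where
      Δ₀⇒Π : ∀ {n} {φ : Formula n} → Δ₀ φ → IsΠ 0 φ
      Σ⇒Π  : ∀ {k n} {φ : Formula n} → IsΣ k φ → IsΠ (suc k) φ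
      all  : ∀ {k n} {φ : Formula (suc n)} → IsΠ (suc k) φ → IsΠ (suc k) (∀' φ)

    data IsΣ : ℕ → ∀ {n} → Formula n → Set where
      Δ₀⇒Σ : ∀ {n} {φ : Formula n} → Δ₀ φ → IsΣ 0 φ
      Π⇒Σ  : ∀ {k n} {φ : Formula n} → IsΠ k φ → IsΣ (suc k) φ
      ex   : ∀ {k n} {φ : Formula (suc n)} → IsΣ (suc k) φ → IsΣ (suc k) (∃' φ)

------------------------------------------------------------------------
-- Deduction methods and Gödel numberings

-- Modus ponens need not be a rule of the method, and soundness is not
-- demanded.  The last three fields record what being a conventional method
-- amounts to: axioms and propositional tautologies are theorems, and the
-- theorems have the indirect-implication property.
record DeductionMethod (L : Language) : Set₁ where
  open Syntax L
  field
    Proof         : Set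
    _proves_from_ : Proof → Sentence → Axioms → Set

  infix 4 _⊢_
  _⊢_ : Axioms → Sentence → Set
  Γ ⊢ φ = ∃[ π ] π proves φ from Γ

  field
    -- Axiom systems are sets: only their members matter.
    extensional : ∀ {Γ Γ′ π φ} → Γ ≐ Γ′ → π proves φ from Γ → π proves φ from Γ′
    axiom       : ∀ {Γ φ} → Γ φ → Γ ⊢ φ
    tautology   : ∀ {Γ φ} → Tautology φ → Γ ⊢ φ
    indirect-implication :
      ∀ {Γ X Y Z} → Γ ⊢ X → Γ ⊢ Y → Γ ⊢ (X ∧' Y) ⇒' Z → Γ ⊢ Z

record GödelNumbering (L : Language) (d : DeductionMethod L) : Set where
  open Syntax L
  open DeductionMethod d
  field
    formula-code           : ∃ Formula → ℕ
    formula-code-injective : Injective _≡_ _≡_ formula-code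
    proof-code             : Proof → ℕ
    proof-code-injective   : Injective _≡_ _≡_ proof-code

  ⌜_⌝ : ∀ {n} → Formula n → ℕ
  ⌜ φ ⌝ = formula-code (_ , φ)

------------------------------------------------------------------------
-- Generic configurations

record GenericConfiguration : Set₁ where
  field
    L : Language
  open Syntax L public
  field
    numeral       : ℕ → Term 0
    numeral-value : ∀ k → value (numeral k) [] ≡ k

    Δ₀              : ∀ {n} → Formula n → Set
    Δ₀-fullyBounded : ∀ {n} {φ : Formula n} → Δ₀ φ → FullyBounded φ
    Δ₀-negation     : ∀ {n} {φ : Formula n} → Δ₀ φ → Δ₀ (¬' φ)
    Add Mult        : Formula 3
    Add-Δ₀          : Δ₀ Add
    Mult-Δ₀         : Δ₀ Mult
    Add-graph       : ∀ x y z → Sat Add  (x ∷ y ∷ z ∷ []) ⇔ x + y ≡ z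
    Mult-graph      : ∀ x y z → Sat Mult (x ∷ y ∷ z ∷ []) ⇔ x * y ≡ z

  open Hierarchy L Δ₀ public

  field
    B : Axioms
    d : DeductionMethod L
    G : GödelNumbering L d
  open DeductionMethod d public
  open GödelNumbering G public

  field
    B-true       : ∀ {φ} → B φ → True φ
    B-Σ₁-proves  : ∀ {φ} → IsΣ 1 φ → True φ → B ⊢ φ
    B-Π₁-refutes : ∀ {φ} → IsΠ 1 φ → ¬ True φ → B ⊢ ¬' φ

module _ (ξ : GenericConfiguration) where
  open GenericConfiguration ξ

  ----------------------------------------------------------------------
  -- Goodness

  -- v < 2^r for rational r, cleared of roots and of negative exponents:
  -- v < 2^(n/q) iff v^q < 2^n.
  _<2^_ : ℕ → ℚᵘ → Set
  v <2^ mkℚᵘ (+ n)    q-1 = v ^ suc q-1 < 2 ^ n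
  v <2^ mkℚᵘ -[1+ n ] q-1 = v ^ suc q-1 * 2 ^ suc n < 1

  -- E bounds exactly the numbers below 2^r.  For a natural number r this
  -- says that E has value 2^r; in general its value is 2^r rounded up,
  -- which gives the real bound v < 2^r its exact meaning.
  Is2^ : Term 0 → ℚᵘ → Set
  Is2^ E r = ∀ v → v < value E [] ⇔ v <2^ r

  -- Good at r ∈ ℚ ∪ {∞}.
  Good : ℚᵘ ⁺ → Sentence → Set
  Good (fin r) Υ = ∃[ E ] Is2^ E r × True (Scope E Υ)
  Good ∞       Υ = True Υ

  AllGood : ℕ → Axioms → Set
  AllGood J θ = ∀ φ → θ φ → Good (fin (+ J / 1)) φ

  -- ♯ θ s: the value of ♯(θ) is s ∈ ℕ ∪ {∞}.
  ♯ : Axioms → ℕ ⁺ → Set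
  ♯ θ (fin J) = AllGood J θ × (∀ K → AllGood K θ → K ≤ J)
  ♯ θ ∞       = ∀ J → AllGood J θ

  ----------------------------------------------------------------------
  -- Stability

  RE-Class : Axioms → Set
  RE-Class θ = (∀ φ → θ φ → IsΠ 1 φ)
             × RecursivelyEnumerable (λ n → ∃[ φ ] θ φ × ⌜ φ ⌝ ≡ n)

  half : ℕ ⁺ → ℚᵘ ⁺
  half (fin J) = fin (½ ℚᵘ.* (+ J / 1))
  half ∞       = ∞

  -- Log p ≤ s + 1, for the real-valued base-2 logarithm.
  Log_≤_+1 : ℕ → ℕ ⁺ → Set
  Log p ≤ fin J +1 = p ≤ 2 ^ (J + 1)
  Log p ≤ ∞     +1 = ⊤

  A-Stable : Set₁
  A-Stable = ∀ θ → RE-Class θ → ∀ s → ♯ θ s →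
    ∀ Υ → IsΠ 1 Υ → ∀ π → π proves Υ from (θ ∪ B) →
    Log proof-code π ≤ s +1 → Good (half s) Υ

  -- Proof codes are meant to be positive; the library has ⌊log₂ 0 ⌋ = 0.
  E-Stable : Set₁
  E-Stable = ∀ θ → RE-Class θ → ∀ s → ♯ θ s →
    ∀ Υ → IsΣ 1 Υ → ∀ π → π proves Υ from (θ ∪ B) →
    Log proof-code π ≤ s +1 →
    Good (fin (½ ℚᵘ.* (+ ⌊log₂ proof-code π ⌋ / 1) ℚᵘ.- 1ℚᵘ)) Υ

  EA-Stable : Set₁
  EA-Stable = E-Stable × A-Stable

  ----------------------------------------------------------------------
  -- Self-consistency

  Consistent : Axioms → Set
  Consistent α = ∀ φ → ¬ (α ⊢ φ × α ⊢ ¬' φ)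

  LevelConsistent : ℕ → Axioms → Set
  LevelConsistent k α = ∀ φ → IsΠ k φ → ¬ (α ⊢ φ × α ⊢ dual φ)

  NegRel : ℕ → ℕ → ℕ → Set
  NegRel k x y = Σ Sentence λ X → IsΠ k X × ⌜ X ⌝ ≡ x × ⌜ dual X ⌝ ≡ y

  -- H results from the formula with code g by replacing every free
  -- variable with the numeral of g.
  SelfInstance : ℕ → Sentence → Set
  SelfInstance g H =
    ∃[ n ] Σ (Formula n) λ φ → ⌜ φ ⌝ ≡ g × H ≡ φ [ replicate n (numeral g) ]

  SubstPrfRel : Axioms → ℕ → ℕ → ℕ → Set
  SubstPrfRel β g t p =
    Σ Sentence λ H → Σ Sentence λ T → Σ Proof λ π →
      SelfInstance g H × ⌜ T ⌝ ≡ t × proof-code π ≡ p × π proves T from (β +ᵃ H)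

  consistencyFormula : Formula 2 → Formula 3 → Formula 1
  consistencyFormula Neg SubstPrf =
    ∀' ∀' ∀' ∀' ¬' ( (Neg [ x ∷ y ∷ [] ])
                   ∧' (SubstPrf [ g ∷ x ∷ p ∷ [] ])
                   ∧' (SubstPrf [ g ∷ y ∷ q ∷ [] ]))
    where
    q p y x g : Term 5
    q = var zero
    p = var (suc zero)
    y = var (suc (suc zero))
    x = var (suc (suc (suc zero)))
    g = var (suc (suc (suc (suc zero))))

  -- The formulas from which SelfCons^k(β , d) is built.
  record Arithmetization (k : ℕ) (β : Axioms) : Set where
    field
      Neg              : Formula 2
      Neg-Δ₀           : Δ₀ Neg
      Neg-defines      : ∀ x y → Sat Neg (x ∷ y ∷ []) ⇔ NegRel k x y
      SubstPrf         : Formula 3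
      SubstPrf-Δ₀      : Δ₀ SubstPrf
      SubstPrf-defines : ∀ g t p →
        Sat SubstPrf (g ∷ t ∷ p ∷ []) ⇔ SubstPrfRel β g t p

    Γ : Formula 1
    Γ = consistencyFormula Neg SubstPrf

    -- Γ at g speaks about the axiom system β + H, where H is the
    -- self-instance of the formula with code g.
    Γ⟨_⟩ : ℕ → Sentence
    Γ⟨ g ⟩ = Γ [ numeral g ∷ [] ]

    SelfCons : Sentence
    SelfCons = Γ⟨ ⌜ Γ ⌝ ⟩

    -- Δ₀ is not assumed closed under conjunction and substitution, so this
    -- is not automatic.
    field
      SelfCons-Π₁ : IsΠ 1 SelfCons

  module _ {k : ℕ} {β : Axioms} (A : Arithmetization k β) where
    open Arithmetization A

    -- σ is the arithmetized assertion that α is Level(k) consistent.  Having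
    -- the right truth value is not enough: 0 = 0 has it for every consistent
    -- α.  Nor is the shape of σ with an arbitrary formula defining the proofs
    -- from α, because of Rosser-style proof predicates.  So σ must be built
    -- from the proof predicate of A.
    StatesConsistency : Axioms → Sentence → Set
    StatesConsistency α σ =
        (∃[ g ] Σ Sentence λ H → SelfInstance g H × α ≐ (β +ᵃ H) × σ ≡ Γ⟨ g ⟩)
      × (True σ ⇔ LevelConsistent k α)

    SelfJustifying : Axioms → Set
    SelfJustifying α =
      (Σ Sentence λ σ → α ⊢ σ × StatesConsistency α σ) × Consistent α

-- Let S be SelfCons¹(B , d).  If B + S were inconsistent, it would prove every
-- sentence, so S would be false.  No sentence is its own dual, so S is Good(0)
-- and ♯{S} is a natural number J.  As S is not Good(J + 1), some Π₁ sentence X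
-- and its dual have proofs from B + S with codes p, q < 2^(J+1).  By
-- A-stability X is Good(J/2), by E-stability its dual is Good(⌊Log q⌋/2 − 1);
-- since ⌊Log q⌋/2 − 1 ≤ J/2, the two are contradictory.  All this refutes a
-- hypothesis, so the classical choice of J is available under ¬¬.

module Submission where

open import Defs

open import Data.Bool.Base using (true; false)
open import Data.Fin.Base using (Fin; zero; suc)
import Data.Integer.Base as ℤ
open ℤ using (+_; -[1+_]; +≤+; -≤+; -≤-)
import Data.Integer.Properties as ℤ
open import Data.Nat.Base
  using (ℕ; zero; suc; _+_; _^_; _≤_; _<_; z≤n; s≤s)
open import Data.Nat.Properties
open import Data.Nat.Logarithm using (⌊log₂_⌋; ⌊log₂⌋-mono-≤; ⌊log₂[2^n]⌋≡n)
open import Data.Product.Base using (Σ; ∃-syntax; _×_; _,_; proj₁; proj₂)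
open import Data.Rational.Unnormalised.Base as ℚᵘ using (mkℚᵘ; ½; 1ℚᵘ; _/_)
open import Data.Sum.Base using (inj₁)
open import Data.Vec.Base using (Vec; []; _∷_; lookup; map; replicate; tabulate)
open import Data.Vec.Properties using (tabulate∘lookup)
open import Function.Base using (_∘_; id)
open import Function.Bundles using (_⇔_; mk⇔; Equivalence)
import Function.Properties.Equivalence as ⇔
open import Relation.Binary.PropositionalEquality
  using (_≡_; _≢_; refl; sym; trans; cong; cong₂; subst)
open import Relation.Nullary.Construct.Add.Supremum renaming ([_] to fin)
open import Relation.Nullary.Negation.Core using (¬_)
open import Relation.Unary using (｛_｝)

open Equivalence using (to; from)

≡⇒⇔ : {A B : Set} → A ≡ B → A ⇔ B
≡⇒⇔ refl = ⇔.refl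

-- Recursively enumerable singletons

constant : ∀ {n} → ℕ → Rec n
constant zero    = comp zer []
constant (suc c) = comp succ (constant c ∷ [])

constant-⇓ : ∀ {n} c {xs : Vec ℕ n} → constant c ⟨ xs ⟩⇓ c
constant-⇓ zero    = ⇓comp [] ⇓zer
constant-⇓ (suc c) = ⇓comp (constant-⇓ c ∷ []) ⇓succ

constant-⇓⁻¹ : ∀ {n} c {xs : Vec ℕ n} {y} → constant c ⟨ xs ⟩⇓ y → c ≡ y
constant-⇓⁻¹ zero    (⇓comp [] ⇓zer)          = refl
constant-⇓⁻¹ (suc c) (⇓comp (c⇓ ∷ []) ⇓succ) = cong suc (constant-⇓⁻¹ c c⇓)

singleton-RE : ∀ {S : ℕ → Set} c → (∀ n → S n ⇔ c ≡ n) → RecursivelyEnumerable S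
singleton-RE c S⇔ = constant c , λ n → mk⇔
  (λ s → 0 , subst (constant c ⟨ 0 ∷ [] ⟩⇓_) (to (S⇔ n) s) (constant-⇓ c))
  (λ (_ , c⇓n) → from (S⇔ n) (constant-⇓⁻¹ c c⇓n))

-- Substitution, relativization and duality

module SyntaxLemmas (L : Language) where
  open Language L
  open Syntax L

  mutual
    value-[] : ∀ {m n} (t : Term n) (σ : Vec (Term m) n) ρ →
               value (t [ σ ]ₜ) ρ ≡ value t (values σ ρ)
    value-[] (var i)    σ ρ = lookup-values i σ ρ
    value-[] (fun f ts) σ ρ = cong ⟦ f ⟧ᶠ (values-[] ts σ ρ)

    values-[] : ∀ {m n k} (ts : Vec (Term n) k) (σ : Vec (Term m) n) ρ →
                values (ts [ σ ]ₜₛ) ρ ≡ values ts (values σ ρ)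
    values-[] []       σ ρ = refl
    values-[] (t ∷ ts) σ ρ = cong₂ _∷_ (value-[] t σ ρ) (values-[] ts σ ρ)

    lookup-values : ∀ {m n} i (σ : Vec (Term m) n) ρ →
                    value (lookup σ i) ρ ≡ lookup (values σ ρ) i
    lookup-values zero    (t ∷ σ) ρ = refl
    lookup-values (suc i) (t ∷ σ) ρ = lookup-values i σ ρ

  values-tabulate-var : ∀ {m n} (f : Fin n → Fin m) ρ →
    values (tabulate (var ∘ f)) ρ ≡ tabulate (lookup ρ ∘ f)
  values-tabulate-var {n = zero}  f ρ = refl
  values-tabulate-var {n = suc n} f ρ =
    cong (_ ∷_) (values-tabulate-var (f ∘ suc) ρ)

  value-wk : ∀ {n} (t : Term n) k ρ → value (wk t) (k ∷ ρ) ≡ value t ρ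
  value-wk t k ρ = trans (value-[] t _ (k ∷ ρ)) (cong (value t)
    (trans (values-tabulate-var suc (k ∷ ρ)) (tabulate∘lookup ρ)))

  values-wk : ∀ {m n} (σ : Vec (Term m) n) k ρ →
              values (map wk σ) (k ∷ ρ) ≡ values σ ρ
  values-wk []      k ρ = refl
  values-wk (t ∷ σ) k ρ = cong₂ _∷_ (value-wk t k ρ) (values-wk σ k ρ)

  values-lift : ∀ {m n} (σ : Vec (Term m) n) k ρ →
                values (lift σ) (k ∷ ρ) ≡ k ∷ values σ ρ
  values-lift σ k ρ = cong (k ∷_) (values-wk σ k ρ)

  value-closed : ∀ {n} (t : Term 0) (ρ : Vec ℕ n) →
                 value (closed t) ρ ≡ value t []
  value-closed t ρ = value-[] t [] ρ

  value-wk-closed : ∀ {n} (t : Term 0) k (ρ : Vec ℕ n) →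
                    value (wk (closed t)) (k ∷ ρ) ≡ value t []
  value-wk-closed t k ρ = trans (value-wk (closed t) k ρ) (value-closed t ρ)

  mutual
    -- Structural induction, mutual with the version under a binder, where `values-lift` identifies
    -- the value of the lifted substitution. The readings ¬(¬ ∧ ¬) and ¬∀¬ only need the
    -- equivalences transported contravariantly.
    Sat-[] : ∀ {m n} (φ : Formula n) (σ : Vec (Term m) n) ρ →
             Sat (φ [ σ ]) ρ ⇔ Sat φ (values σ ρ)
    Sat-[] (t ≈' u) σ ρ = ≡⇒⇔ (cong₂ _≡_ (value-[] t σ ρ) (value-[] u σ ρ))
    Sat-[] (t ≤' u) σ ρ = ≡⇒⇔ (cong₂ _≤_ (value-[] t σ ρ) (value-[] u σ ρ))
    Sat-[] (¬' φ) σ ρ = let e = Sat-[] φ σ ρ in mk⇔ (_∘ from e) (_∘ to e)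
    Sat-[] (φ ∧' ψ) σ ρ = let e = Sat-[] φ σ ρ ; f = Sat-[] ψ σ ρ in mk⇔
      (λ (a , b) → to e a , to f b)
      (λ (a , b) → from e a , from f b)
    Sat-[] (φ ∨' ψ) σ ρ = let e = Sat-[] φ σ ρ ; f = Sat-[] ψ σ ρ in mk⇔
      (λ h (a , b) → h (a ∘ to e , b ∘ to f))
      (λ h (a , b) → h (a ∘ from e , b ∘ from f))
    Sat-[] (φ ⇒' ψ) σ ρ = let e = Sat-[] φ σ ρ ; f = Sat-[] ψ σ ρ in mk⇔
      (λ h → to f ∘ h ∘ from e)
      (λ h → from f ∘ h ∘ to e)
    Sat-[] (∀' φ) σ ρ = mk⇔
      (λ h k → to (Sat-[]-lift φ σ k ρ) (h k))
      (λ h k → from (Sat-[]-lift φ σ k ρ) (h k))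
    Sat-[] (∃' φ) σ ρ = mk⇔
      (λ h g → h λ k → g k ∘ to (Sat-[]-lift φ σ k ρ))
      (λ h g → h λ k → g k ∘ from (Sat-[]-lift φ σ k ρ))
    Sat-[] (∀≤ t φ) σ ρ rewrite value-[] t σ ρ = mk⇔
      (λ h k k≤ → to (Sat-[]-lift φ σ k ρ) (h k k≤))
      (λ h k k≤ → from (Sat-[]-lift φ σ k ρ) (h k k≤))
    Sat-[] (∃≤ t φ) σ ρ rewrite value-[] t σ ρ = mk⇔
      (λ h g → h λ k k≤ → g k k≤ ∘ to (Sat-[]-lift φ σ k ρ))
      (λ h g → h λ k k≤ → g k k≤ ∘ from (Sat-[]-lift φ σ k ρ))

    Sat-[]-lift : ∀ {m n} (φ : Formula (suc n)) (σ : Vec (Term m) n) k ρ →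
                  Sat (φ [ lift σ ]) (k ∷ ρ) ⇔ Sat φ (k ∷ values σ ρ)
    Sat-[]-lift φ σ k ρ = ⇔.trans (Sat-[] φ (lift σ) (k ∷ ρ))
      (≡⇒⇔ (cong (Sat φ) (values-lift σ k ρ)))

  Sat-∀< : ∀ {n} (E : Term 0) (φ : Formula (suc n)) ρ →
           Sat (∀< (closed E) φ) ρ ⇔ (∀ k → k < value E [] → Sat φ (k ∷ ρ))
  Sat-∀< E φ ρ = mk⇔
    (λ h k k<E → h k (subst (k ≤_) (sym (value-closed E ρ)) (<⇒≤ k<E))
                   (<⇒≱ k<E ∘ subst (_≤ k) (value-wk-closed E k ρ)))
    (λ h k _ E≰k → h k (≰⇒> (E≰k ∘ subst (_≤ k) (sym (value-wk-closed E k ρ)))))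

  Sat-∃<⁻¹ : ∀ {n} (E : Term 0) (φ : Formula (suc n)) ρ →
             Sat (∃< (closed E) φ) ρ → ¬ (∀ k → k < value E [] → ¬ Sat φ (k ∷ ρ))
  Sat-∃<⁻¹ E φ ρ h g = h λ k _ (E≰k , s) →
    g k (≰⇒> (E≰k ∘ subst (_≤ k) (sym (value-wk-closed E k ρ)))) s

  -- `dual` ends in a catch-all clause, which computes only once the head symbol is known. Full
  -- boundedness excludes the two unbounded quantifiers; every other head falls into that clause.
  FullyBounded⇒dual : ∀ {n} {φ : Formula n} → FullyBounded φ → dual φ ≡ ¬' φ
  FullyBounded⇒dual eq         = refl
  FullyBounded⇒dual le         = refl
  FullyBounded⇒dual (neg _)    = refl
  FullyBounded⇒dual (conj _ _) = refl
  FullyBounded⇒dual (disj _ _) = refl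
  FullyBounded⇒dual (impl _ _) = refl
  FullyBounded⇒dual (all≤ _)   = refl
  FullyBounded⇒dual (ex≤ _)    = refl

  FullyBounded⇒Scope : ∀ {n} E {φ : Formula n} → FullyBounded φ → Scope E φ ≡ φ
  FullyBounded⇒Scope E eq         = refl
  FullyBounded⇒Scope E le         = refl
  FullyBounded⇒Scope E (neg _)    = refl
  FullyBounded⇒Scope E (conj _ _) = refl
  FullyBounded⇒Scope E (disj _ _) = refl
  FullyBounded⇒Scope E (impl _ _) = refl
  FullyBounded⇒Scope E (all≤ _)   = refl
  FullyBounded⇒Scope E (ex≤ _)    = refl

  explosion-tautology : ∀ φ ψ → Tautology ((φ ∧' (¬' φ)) ⇒' ψ)
  explosion-tautology φ ψ v is
    rewrite IsValuation.v-⇒ is (φ ∧' (¬' φ)) ψ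
          | IsValuation.v-∧ is φ (¬' φ)
          | IsValuation.v-¬ is φ
    with v φ
  ... | true  = refl
  ... | false = refl

-- Bounds of the form 2^r

<2^-mono : ∀ ξ v {m n} q → m ℤ.≤ n →
           _<2^_ ξ v (mkℚᵘ m q) → _<2^_ ξ v (mkℚᵘ n q)
<2^-mono ξ v q (+≤+ m≤n) v< = <-≤-trans v< (^-monoʳ-≤ 2 m≤n)
-- A negative exponent on the left forces v^(q+1) < 1, and 1 ≤ 2^n.
<2^-mono ξ v q (-≤+ {m} {n}) v< =
  <-≤-trans (≤-<-trans (m≤m*n (v ^ suc q) (2 ^ suc m) {{m^n≢0 2 (suc m)}}) v<)
            (m^n>0 2 n)
<2^-mono ξ v q (-≤- n≤m) v< =
  ≤-<-trans (*-monoʳ-≤ (v ^ suc q) (^-monoʳ-≤ 2 (s≤s n≤m))) v<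

-- As ⌊Log q⌋ ≤ J + 1, the exponent ⌊Log q⌋/2 - 1 is at most (J - 1)/2. Hence the range of the
-- existential witnesses from E-stability lies inside the range of the universal quantifiers from
-- A-stability.
half-log-bound : ∀ ξ v {q J} → q < 2 ^ suc J →
  _<2^_ ξ v (½ ℚᵘ.* (+ ⌊log₂ q ⌋ / 1) ℚᵘ.- 1ℚᵘ) →
  _<2^_ ξ v (½ ℚᵘ.* (+ J / 1))
half-log-bound ξ v {q} {J} q< = <2^-mono ξ v 1 numerators
  where
  l = ⌊log₂ q ⌋

  l≤1+J : l ≤ suc J
  -- Monotonicity covers q = 0 as well, where the logarithm has the default value 0.
  l≤1+J = subst (l ≤_) (⌊log₂[2^n]⌋≡n (suc J)) (⌊log₂⌋-mono-≤ (<⇒≤ q<))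

  open ℤ.≤-Reasoning

  -- Over the common denominator 2 the exponents have numerators l - 2 and J.
  numerators : + 1 ℤ.* + l ℤ.* + 1 ℤ.+ -[1+ 1 ] ℤ.≤ + 1 ℤ.* + J
  numerators = begin
    + 1 ℤ.* + l ℤ.* + 1 ℤ.+ -[1+ 1 ]
      ≡⟨ cong (ℤ._+ -[1+ 1 ]) (trans (ℤ.*-identityʳ _) (ℤ.*-identityˡ (+ l))) ⟩
    + l ℤ.+ -[1+ 1 ]      ≤⟨ ℤ.+-monoˡ-≤ -[1+ 1 ] (+≤+ l≤1+J) ⟩
    + suc J ℤ.+ -[1+ 1 ]  ≡⟨ ℤ.[1+m]⊖[1+n]≡m⊖n J 1 ⟩
    J ℤ.⊖ 1               ≤⟨ ℤ.m⊖n≤m J 1 ⟩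
    + J                   ≡⟨ ℤ.*-identityˡ (+ J) ⟨
    + 1 ℤ.* + J           ∎

-- Codes, explosion and duality in a generic configuration.

module _ (ξ : GenericConfiguration) where
  open GenericConfiguration ξ
  open SyntaxLemmas L

  ⌜⌝-injective : ∀ {φ ψ : Sentence} → ⌜ φ ⌝ ≡ ⌜ ψ ⌝ → φ ≡ ψ
  ⌜⌝-injective e = sentence (formula-code-injective e)
    where
    sentence : ∀ {φ ψ : Sentence} → (0 , φ) ≡ (0 , ψ) → φ ≡ ψ
    sentence refl = refl

  SelfInstance-unique : ∀ {φ : Formula 1} {H} → SelfInstance ξ ⌜ φ ⌝ H →
                        H ≡ φ [ numeral ⌜ φ ⌝ ∷ [] ]
  SelfInstance-unique {φ} (n , ψ , e , refl) =
    go ψ (formula-code-injective e)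
    where
    -- With both arities general, the equation between pairs can be matched with `refl`.
    go : ∀ {m n} {φ : Formula n} {g} (ψ : Formula m) → (m , ψ) ≡ (n , φ) →
         ψ [ replicate m (numeral g) ] ≡ φ [ replicate n (numeral g) ]
    go ψ refl = refl

  -- Modus ponens may be absent, so indirect implication is applied to φ, ¬φ and the tautology (φ ∧
  -- ¬φ) ⇒ ψ.
  explosion : ∀ {α φ} → α ⊢ φ → α ⊢ ¬' φ → ∀ ψ → α ⊢ ψ
  explosion {φ = φ} φ! ¬φ! ψ =
    indirect-implication φ! ¬φ! (tautology (explosion-tautology φ ψ))

  dual-Π₁ : ∀ {n} {φ : Formula n} → IsΠ 1 φ → IsΣ 1 (dual φ)
  dual-Π₁ (Σ⇒Π (Δ₀⇒Σ δ)) = Π⇒Σ (Δ₀⇒Π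
    (subst Δ₀ (sym (FullyBounded⇒dual (Δ₀-fullyBounded δ))) (Δ₀-negation δ)))
  dual-Π₁ (all π) = ex (dual-Π₁ π)

  -- Dualizing turns a leading ∀ into ∃; a Δ₀ formula would have to equal its own negation, hence
  -- contain itself properly.
  dual-≢ : ∀ {n} {φ : Formula n} → IsΠ 1 φ → φ ≢ dual φ
  dual-≢ {φ = φ} (Σ⇒Π (Δ₀⇒Σ δ)) e
    with () ← trans e (FullyBounded⇒dual (Δ₀-fullyBounded δ))
  dual-≢ (all _) ()

  -- Induction on the prefix: every candidate witness below F is also below E, where the universal
  -- quantifier applies. At the Δ₀ matrix both scopes are void, leaving a formula and its negation.
  Scope-dual-contradiction : ∀ {n} {φ : Formula n} → IsΠ 1 φ → ∀ E F →
    (∀ v → v < value F [] → v < value E []) →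
    ∀ ρ → Sat (Scope E φ) ρ → ¬ Sat (Scope F (dual φ)) ρ
  Scope-dual-contradiction (Σ⇒Π (Δ₀⇒Σ δ)) E F F⊆E ρ s
    rewrite FullyBounded⇒dual (Δ₀-fullyBounded δ)
          | FullyBounded⇒Scope E (Δ₀-fullyBounded δ) = λ ¬s → ¬s s
  Scope-dual-contradiction (all π) E F F⊆E ρ s t =
    Sat-∃<⁻¹ F _ ρ t λ k k<F →
      Scope-dual-contradiction π E F F⊆E (k ∷ ρ)
        (to (Sat-∀< E _ ρ) s k (F⊆E k k<F))

  -- The meaning of `SelfCons` in Standard-M.

  module _ {k : ℕ} {β : Axioms} (A : Arithmetization ξ k β) where
    open Arithmetization A

    α : Axioms
    α = β +ᵃ SelfCons

    ProofOf : Sentence → ℕ → Set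
    ProofOf φ p = ∃[ π ] proof-code π ≡ p × π proves φ from α

    Clash : ℕ → ℕ → ℕ → ℕ → Set
    Clash x y p q = Σ Sentence λ X →
      IsΠ k X × ⌜ X ⌝ ≡ x × ⌜ dual X ⌝ ≡ y × ProofOf X p × ProofOf (dual X) q

    -- This is the fixed point: the only self-instance of the formula coded by ⌜ Γ ⌝ is `SelfCons`
    -- itself, so at that code the system β + H is α.
    SubstPrfRel⇔ProofOf : ∀ φ p → SubstPrfRel ξ β ⌜ Γ ⌝ ⌜ φ ⌝ p ⇔ ProofOf φ p
    SubstPrfRel⇔ProofOf φ p = mk⇔ fwd
      (λ (π , e , pr) → SelfCons , φ , π , (1 , Γ , refl , refl) , refl , e , pr)
      where
      fwd : SubstPrfRel ξ β ⌜ Γ ⌝ ⌜ φ ⌝ p → ProofOf φ p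
      fwd (H , T , π , inst , eqT , e , pr)
        rewrite SelfInstance-unique {Γ} inst | ⌜⌝-injective eqT = π , e , pr

    private
      vq vp vy vx vg : Term 5
      vq = var zero
      vp = var (suc zero)
      vy = var (suc (suc zero))
      vx = var (suc (suc (suc zero)))
      vg = var (suc (suc (suc (suc zero))))

      σ₀ : Vec (Term 0) 1
      σ₀ = numeral ⌜ Γ ⌝ ∷ []
      σ₁ = lift σ₀
      σ₂ = lift σ₁
      σ₃ = lift σ₂
      σ  = lift σ₃

    -- SelfCons is ∀x∀y∀p∀q of this formula.
    matrix : Formula 4
    matrix = (¬' ((Neg [ vx ∷ vy ∷ [] ])
               ∧' (SubstPrf [ vg ∷ vx ∷ vp ∷ [] ])
               ∧' (SubstPrf [ vg ∷ vy ∷ vq ∷ [] ]))) [ σ ]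

    module _ (x y p q : ℕ) where
      private
        ρ : Vec ℕ 4
        ρ = q ∷ p ∷ y ∷ x ∷ []

        values-σ : values σ ρ ≡ q ∷ p ∷ y ∷ x ∷ ⌜ Γ ⌝ ∷ []
        values-σ =
          trans (values-lift σ₃ q (p ∷ y ∷ x ∷ [])) (cong (q ∷_)
          (trans (values-lift σ₂ p (y ∷ x ∷ [])) (cong (p ∷_)
          (trans (values-lift σ₁ y (x ∷ [])) (cong (y ∷_)
          (trans (values-lift σ₀ x []) (cong (λ g → x ∷ g ∷ [])
          (numeral-value ⌜ Γ ⌝))))))))

        -- Two substitutions are undone: `σ` puts the numeral of ⌜ Γ ⌝ for g, and `τ` selects the
        -- variables that each conjunct uses.
        Sat-σ : ∀ {n} (φ : Formula n) τ →
          Sat (φ [ τ ] [ σ ]) ρ ⇔ Sat φ (values τ (q ∷ p ∷ y ∷ x ∷ ⌜ Γ ⌝ ∷ []))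
        Sat-σ φ τ = ⇔.trans (Sat-[] (φ [ τ ]) σ ρ)
          (⇔.trans (≡⇒⇔ (cong (Sat (φ [ τ ])) values-σ)) (Sat-[] φ τ _))

        neg⇔ = ⇔.trans (Sat-σ Neg (vx ∷ vy ∷ [])) (Neg-defines x y)
        prfˣ⇔ = ⇔.trans (Sat-σ SubstPrf (vg ∷ vx ∷ vp ∷ [])) (SubstPrf-defines ⌜ Γ ⌝ x p)
        prfʸ⇔ = ⇔.trans (Sat-σ SubstPrf (vg ∷ vy ∷ vq ∷ [])) (SubstPrf-defines ⌜ Γ ⌝ y q)

      Sat-matrix : Sat matrix ρ ⇔ (¬ Clash x y p q)
      Sat-matrix = mk⇔
        (λ h → λ { (X , π , refl , refl , prX , prY) → h
          ( from neg⇔ (X , π , refl , refl)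
          , from prfˣ⇔ (from (SubstPrfRel⇔ProofOf X p) prX)
          , from prfʸ⇔ (from (SubstPrfRel⇔ProofOf (dual X) q) prY)) })
        (λ h (n , a , b) → h (clash (to neg⇔ n) (to prfˣ⇔ a) (to prfʸ⇔ b)))
        where
        clash : NegRel ξ k x y → SubstPrfRel ξ β ⌜ Γ ⌝ x p →
                SubstPrfRel ξ β ⌜ Γ ⌝ y q → Clash x y p q
        clash (X , π , refl , refl) a b = X , π , refl , refl ,
          to (SubstPrfRel⇔ProofOf X p) a , to (SubstPrfRel⇔ProofOf (dual X) q) b

    True-SelfCons : True SelfCons ⇔ (∀ x y p q → ¬ Clash x y p q)
    True-SelfCons = mk⇔
      (λ h x y p q → to (Sat-matrix x y p q) (h x y p q))
      (λ h x y p q → from (Sat-matrix x y p q) (h x y p q))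

    -- Goodness and truth of `SelfCons`, and the value of ♯.

    NoClashBelow : ℕ → Set
    NoClashBelow b = ∀ x → x < b → ∀ y → y < b → ∀ p → p < b → ∀ q → q < b →
                     ¬ Clash x y p q

    NoClashBelow-anti : ∀ {a b} → a ≤ b → NoClashBelow b → NoClashBelow a
    NoClashBelow-anti a≤b h x x< y y< p p< q q< =
      h x (<-≤-trans x< a≤b) y (<-≤-trans y< a≤b)
        p (<-≤-trans p< a≤b) q (<-≤-trans q< a≤b)

    True-Scope-SelfCons : ∀ E → True (Scope E SelfCons) ⇔ NoClashBelow (value E [])
    True-Scope-SelfCons E = mk⇔
      (λ h x x< y y< p p< q q< → to (Sat-matrix x y p q)
        (to (∀q x y p) (to (∀p x y) (to (∀y x) (to ∀x h x x<) y y<) p p<) q q<))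
      (λ h → from ∀x λ x x< → from (∀y x) λ y y< → from (∀p x y) λ p p< →
        from (∀q x y p) λ q q< → from (Sat-matrix x y p q) (h x x< y y< p p< q q<))
      where
      ∀x = Sat-∀< E (Scope E (∀' ∀' ∀' matrix)) []
      ∀y = λ x → Sat-∀< E (Scope E (∀' ∀' matrix)) (x ∷ [])
      ∀p = λ x y → Sat-∀< E (Scope E (∀' matrix)) (y ∷ x ∷ [])
      ∀q = λ x y p → Sat-∀< E matrix (p ∷ y ∷ x ∷ [])

    Good-SelfCons : ∀ J → Good ξ (fin (+ J / 1)) SelfCons ⇔ NoClashBelow (2 ^ J)
    Good-SelfCons J = mk⇔
      (λ (E , E≡2^J , s) →
        subst NoClashBelow (same-bound (value E []) E≡2^J)
          (to (True-Scope-SelfCons E) s))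
      (λ h → numeral (2 ^ J) ,
        (λ v → ≡⇒⇔ (cong₂ _<_ (sym (^-identityʳ v)) (numeral-value (2 ^ J)))) ,
        from (True-Scope-SelfCons (numeral (2 ^ J)))
          (subst NoClashBelow (sym (numeral-value (2 ^ J))) h))
      where
      -- The term E in `Good` is arbitrary, but `Is2^` fixes its value. The exponent J has
      -- denominator 1, whence v ^ 1.
      same-bound : ∀ b → (∀ v → v < b ⇔ v ^ 1 < 2 ^ J) → b ≡ 2 ^ J
      same-bound b e = ≤-antisym
        (≮⇒≥ λ 2^J<b → <-irrefl (^-identityʳ _) (to (e _) 2^J<b))
        (≮⇒≥ λ b<2^J → <-irrefl refl
          (from (e b) (subst (_< 2 ^ J) (sym (^-identityʳ b)) b<2^J)))

    SelfCons⇔LevelConsistent : True SelfCons ⇔ LevelConsistent ξ k α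
    SelfCons⇔LevelConsistent = ⇔.trans True-SelfCons (mk⇔
      (λ h X π ((a , prX) , (b , prY)) → h _ _ _ _
        (X , π , refl , refl , (a , refl , prX) , (b , refl , prY)))
      (λ h x y p q (X , π , _ , _ , (a , _ , prX) , (b , _ , prY)) →
        h X π ((a , prX) , (b , prY))))

    SelfCons-states-consistency : StatesConsistency ξ A α SelfCons
    SelfCons-states-consistency =
      (⌜ Γ ⌝ , SelfCons , (1 , Γ , refl , refl) , (id , id) , refl) ,
      SelfCons⇔LevelConsistent

    RE-Class-SelfCons : k ≡ 1 → RE-Class ξ ｛ SelfCons ｝
    RE-Class-SelfCons refl =
      (λ { φ refl → SelfCons-Π₁ }) ,
      singleton-RE ⌜ SelfCons ⌝ λ n → mk⇔
        (λ { (φ , refl , e) → e })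
        (λ e → SelfCons , refl , e)

    -- The ¬¬-form of the existence of a last J without a clash below 2^J: otherwise induction on J
    -- would exclude clashes below every power of 2, and every clash lies below one.
    ¬¬-boundary : NoClashBelow 1 → ¬ True SelfCons →
      ¬ (∀ J → NoClashBelow (2 ^ J) → ¬ ¬ NoClashBelow (2 ^ suc J))
    ¬¬-boundary h₀ untrue step = untrue (from True-SelfCons λ x y p q →
      -- The sum dominates all four numbers and is itself less than 2^b.
      let b = x + y + (p + q)
          b<  = n<2^n b
          x≤b = ≤-trans (m≤m+n x y) (m≤m+n _ _)
          y≤b = ≤-trans (m≤n+m y x) (m≤m+n _ _)
          p≤b = ≤-trans (m≤m+n p q) (m≤n+m _ (x + y))
          q≤b = ≤-trans (m≤n+m q p) (m≤n+m _ (x + y))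
      in none b x (≤-<-trans x≤b b<) y (≤-<-trans y≤b b<)
                p (≤-<-trans p≤b b<) q (≤-<-trans q≤b b<))
      where
      n<2^n : ∀ n → n < 2 ^ n
      n<2^n zero    = s≤s z≤n
      n<2^n (suc n) = +-mono-≤ (m^n>0 2 n) (≤-trans (n<2^n n) (m≤m+n _ 0))

      none : ∀ J → NoClashBelow (2 ^ J)
      none zero    = h₀
      none (suc J) x x< y y< p p< q q< c =
        -- Freedom from clashes is a negative statement, so the double negation can be removed.
        step J (none J) λ h → h x x< y y< p p< q q< c

    -- `NoClashBelow` is antitone in its bound, so failure at J + 1 rules out goodness at every K >
    -- J.
    ♯-SelfCons : ∀ J → NoClashBelow (2 ^ J) → ¬ NoClashBelow (2 ^ suc J) →
                 ♯ ξ ｛ SelfCons ｝ (fin J)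
    ♯-SelfCons J h ¬h =
      (λ { φ refl → from (Good-SelfCons J) h }) ,
      λ K good → ≮⇒≥ λ J<K → ¬h (NoClashBelow-anti (^-monoʳ-≤ 2 J<K)
        (to (Good-SelfCons K) (good SelfCons refl)))

  -- Consistency from EA-stability.

  module _ (stable : EA-Stable ξ) (A : Arithmetization ξ 1 B) where
    open Arithmetization A

    -- Below 1 both codes are 0, so X and its dual would coincide.
    NoClashBelow-1 : NoClashBelow A 1
    NoClashBelow-1 x (s≤s z≤n) y (s≤s z≤n) p _ q _ (X , π , eqX , eqY , _) =
      dual-≢ π (⌜⌝-injective (trans eqX (sym eqY)))

    -- Assuming failure at J + 1 makes ♯ equal to J, so both stability notions apply with θ = ｛
    -- SelfCons ｝, for which θ ∪ B is the system itself. They make X and its dual good at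
    -- incompatible bounds.
    NoClashBelow-step : ∀ J → NoClashBelow A (2 ^ J) → ¬ ¬ NoClashBelow A (2 ^ suc J)
    NoClashBelow-step J h ¬h = ¬h λ
      { x _ y _ p p< q q< (X , isΠ , _ , _ , (a , refl , prX) , (b , refl , prY)) →
        let re = RE-Class-SelfCons A refl
            ♯J = ♯-SelfCons A J h ¬h
            code-bound : ∀ {n : ℕ} → n < 2 ^ suc J → n ≤ 2 ^ (J + 1)
            code-bound n< = ≤-trans (<⇒≤ n<) (≤-reflexive (cong (2 ^_) (+-comm 1 J)))
            -- E-stability bounds the dual's witnesses through the code of its own proof;
            -- A-stability bounds X through ♯.
            F , F≡ , t = proj₁ stable _ re (fin J) ♯J (dual X) (dual-Π₁ isΠ) b prY
                           (code-bound q<)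
            E , E≡ , s = proj₂ stable _ re (fin J) ♯J X isΠ a prX (code-bound p<)
        in Scope-dual-contradiction isΠ E F
             (λ v → from (E≡ v) ∘ half-log-bound ξ v q< ∘ to (F≡ v)) [] s t }

    SelfCons-consistent : Consistent ξ (B +ᵃ SelfCons)
    SelfCons-consistent φ (φ! , ¬φ!) = ¬¬-boundary A NoClashBelow-1
      -- By explosion, an inconsistent system proves the Π₁ sentence `SelfCons` and its dual, so
      -- level-1 consistency fails and `SelfCons` is false.
      (λ s → to (SelfCons⇔LevelConsistent A) s SelfCons SelfCons-Π₁
        (explosion φ! ¬φ! SelfCons , explosion φ! ¬φ! (dual SelfCons)))
      NoClashBelow-step

theorem5p9 : (ξ : GenericConfiguration) → EA-Stable ξ →
    (A : Arithmetization ξ 1 (GenericConfiguration.B ξ)) →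
    let open GenericConfiguration ξ
        open Arithmetization A
    in SelfJustifying ξ A (B +ᵃ SelfCons)
theorem5p9 ξ stable A =
  (SelfCons , axiom (inj₁ refl) , SelfCons-states-consistency ξ A) ,
  SelfCons-consistent ξ stable A
  where
  open GenericConfiguration ξ
  open Arithmetization A
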